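{- Let $V$ be a finite set with $|V| = n$, where $n$ is prime, and let $c: V \rightarrow V$ be a cyclic permutation of $V$ (a single $n$-cycle). Then the set of nonconstant colorings $\chi: V \rightarrow \mathbb{P}$ is the disjoint union $$\biguplus_{\pi\in \mathfrak{S}_V} A(\pi, \mathrm{Des}(\pi c \pi^{ -1})).$$
   Context: $\mathbb{P} = \{1,2,\ldots\}$. $\mathfrak{S}_V$ denotes the set of bijections $\pi: V \rightarrow [n]$. For $\pi \in \mathfrak{S}_V$ and $S \subseteq [n-1]$, $A(\pi,S)$ is the set of maps $\chi: V \rightarrow \mathbb{P}$ such that $\chi(\pi^{ -1}(1)) \le \chi(\pi^{ -1}(2)) \le \cdots \le \chi(\pi^{ -1}(n))$ and $\chi(\pi^{ -1}(i)) < \chi(\pi^{ -1}(i+1))$ whenever $i \in S$. For a permutation $\sigma$ of $[n]$, its descent set is $\mathrm{Des}(\sigma) = \{ i \in [n-1] : \sigma(i) > \sigma(i+1)\}$; here $\pi c \pi^{ -1}$ is a permutation of $[n]$. -}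

module Defs where

open import Data.Fin using (Fin; suc; inject₁; toℕ; _>_)
open import Data.Fin.Permutation using (Permutation′)
open import Data.Nat as ℕ using (ℕ; suc; pred; NonZero)
open import Data.Nat.DivMod using (_mod_)
open import Data.Product using (Σ; Σ-syntax; ∃-syntax; _×_; proj₁)
open import Function.Bundles using (_↔_; module Inverse)
open import Function.Properties.Inverse using (↔-sym; ↔-trans)
open import Level using (Level; 0ℓ; _⊔_)
open import Relation.Binary.Core using (Rel)
open import Relation.Binary.PropositionalEquality using (_≡_; _≗_)
open import Relation.Nullary using (¬_)
open import Relation.Unary using (Pred; _∈_; _≐_; _⊥_; ⋃)

open Inverse using (to; from)

private
  variable
    a i ℓ ℓ₁ ℓ₂ : Level
    n : ℕ

ℙ : Set
ℙ = Σ ℕ NonZero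

infix 4 _≤ℙ_ _<ℙ_

_≤ℙ_ _<ℙ_ : Rel ℙ 0ℓ
p ≤ℙ q = proj₁ p ℕ.≤ proj₁ q
p <ℙ q = proj₁ p ℕ.< proj₁ q

Coloring : Set a → Set a
Coloring V = V → ℙ

Constant : {V : Set a} → Pred (Coloring V) a
Constant χ = ∃[ p ] (∀ v → χ v ≡ p)

Nonconstant : {V : Set a} → Pred (Coloring V) a
Nonconstant χ = ¬ Constant χ

-- [n] is represented by Fin n and [n-1] by Fin (pred n), both shifted to
-- start at 0.  For i ∈ [n-1], lower i and upper i are the elements i and
-- i + 1 of [n].

lower upper : Fin (pred n) → Fin n
lower {suc _} = inject₁
upper {suc _} = suc

𝔖 : Set a → ℕ → Set a
𝔖 V n = V ↔ Fin n

-- Without function extensionality, bijections are compared pointwise.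

infix 4 _≈𝔖_

_≈𝔖_ : {V : Set a} → Rel (𝔖 V n) a
π ≈𝔖 ρ = to π ≗ to ρ

A : {V : Set a} → 𝔖 V n → Pred (Fin (pred n)) ℓ → Pred (Coloring V) ℓ
A π S χ =
    (∀ i → χ (from π (lower i)) ≤ℙ χ (from π (upper i)))
  × (∀ i → i ∈ S → χ (from π (lower i)) <ℙ χ (from π (upper i)))

Des : Permutation′ n → Pred (Fin (pred n)) 0ℓ
Des σ i = to σ (lower i) > to σ (upper i)

-- The permutation π c π⁻¹ of [n] (↔-trans composes in diagrammatic order).

conjugate : {V : Set a} → 𝔖 V n → V ↔ V → Permutation′ n
conjugate π c = ↔-trans (↔-sym π) (↔-trans c π)

next : Fin n → Fin n
next {n = suc m} k = suc (toℕ k) mod suc m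

-- c = (v₀ v₁ … vₙ₋₁) for an enumeration v₀, …, vₙ₋₁ of all of V.

IsCycle : {V : Set a} → ℕ → V ↔ V → Set a
IsCycle {V = V} n c =
  Σ[ v ∈ (Fin n ↔ V) ] (∀ k → to c (to v k) ≡ to v (next k))

IsDisjointUnion : {X : Set a} {I : Set i} → Rel I ℓ →
                  Pred X ℓ₁ → (I → Pred X ℓ₂) → Set (a ⊔ i ⊔ ℓ ⊔ ℓ₁ ⊔ ℓ₂)
IsDisjointUnion {I = I} _≈_ P F =
    (P ≐ ⋃ I F)
  × (∀ j k → ¬ (j ≈ k) → F j ⊥ F k)

{-# OPTIONS --safe #-}

-- A bijection π with χ ∈ A(π, Des(π c π⁻¹)) is one that lists V in
-- lexicographic order of the colour words (χ(v), χ(c v), χ(c² v), …): if v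
-- precedes w, then χ(v) ≤ χ(w), and in case of equality c v precedes c w.
-- Two such π ordering v, w differently would give c^k v before c^k w for all k;
-- writing w = c^d v, this is an infinite increasing chain v, c^d v, c^2d v, ….
-- Conversely, if χ is not constant, the words are pairwise distinct: equal words
-- at v ≠ c^d v make χ(c^k v) periodic in k with the coprime periods d and n.

module Submission where

open import Defs
open import Data.Empty using (⊥)
open import Data.Fin as Fin using (Fin; zero; suc; inject₁; toℕ; fromℕ<; punchOut)
open import Data.Fin.Induction using (<-weakInduction; <-weakInduction-startingFrom)
import Data.Fin.Properties as Fin
open import Data.Fin.Subset as Subset using (Subset; ∣_∣)
open import Data.Fin.Subset.Properties using (p⊂q⇒∣p∣<∣q∣; ∣⊤∣≡n; ∈⊤)
open import Data.Nat using (ℕ; zero; suc; _+_; _*_; _∸_; pred; _≤_; _<_; z≤n; s≤s; s<s⁻¹; NonZero; >-nonZero)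
open import Data.Nat.Coprimality using (Coprime; coprime-Bézout; prime⇒coprime)
open import Data.Nat.DivMod using (_%_; _/_; _mod_; m%n<n; m≡m%n+[m/n]*n; [m+n]%n≡m%n; m<n⇒m%n≡m; m%n%n≡m%n; %-distribˡ-+)
open import Data.Nat.GCD using (module Bézout)
open import Data.Nat.GeneralisedArithmetic using (fold)
open import Data.Nat.Primality using (Prime; ¬prime[0]; ¬prime[1])
open import Data.Nat.Properties hiding (_<?_)
open import Data.Product using (Σ-syntax; ∃-syntax; _×_; _,_; proj₁; proj₂)
open import Data.Sum using (_⊎_; inj₁; inj₂)
open import Data.Vec using (tabulate)
open import Data.Vec.Properties using (lookup∘tabulate; []=⇒lookup; lookup⇒[]=)
open import Function.Base using (_∘_)
open import Function.Bundles using (_↔_; mk⤖; module Inverse; module Bijection)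
open import Function.Consequences.Propositional using (strictlySurjective⇒surjective)
open import Function.Definitions using (Injective; StrictlySurjective)
open import Function.Properties.Bijection using (⤖⇒↔)
open import Function.Properties.Inverse using (↔⇒⤖; ↔-sym)
open import Level using (Level)
open import Relation.Binary.Core using (Rel)
open import Relation.Binary.Definitions using (Transitive; Tri; tri<; tri≈; tri>)
open import Relation.Binary.PropositionalEquality using (_≡_; _≢_; refl; sym; trans; cong; subst; subst₂; isEquivalence; module ≡-Reasoning)
open import Relation.Binary.Structures using (IsStrictTotalOrder)
open import Relation.Nullary using (¬_; yes; no; does; contradiction)
open import Relation.Nullary.Decidable using (dec-true)

open Inverse using (to; from; strictlyInverseˡ; strictlyInverseʳ)

private
  variable
    a ℓ : Level
    m n : ℕ

↔-injective : ∀ {b} {X : Set a} {Y : Set b} (f : X ↔ Y) → Injective _≡_ _≡_ (to f)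
↔-injective f = Bijection.injective (↔⇒⤖ f)

-- Monotone maps and ranks on finite sets

-- A missed value could be punched out of the codomain, leaving an injection into a smaller `Fin`.
injective⇒surjective : {f : Fin n → Fin n} → Injective _≡_ _≡_ f → StrictlySurjective _≡_ f
injective⇒surjective {n = suc _} {f} inj y with Fin.any? (λ x → f x Fin.≟ y)
... | yes p  = p
... | no  ∄x = contradiction
  (λ {x} {x′} eq → inj (Fin.punchOut-injective (y≢f x) (y≢f x′) eq))
  (Fin.<⇒notInjective {f = λ x → punchOut (y≢f x)} ≤-refl)
  where
  y≢f : ∀ x → y ≢ f x
  y≢f x y≡fx = ∄x (x , sym y≡fx)

increasing⇒expansive : (f : Fin m → Fin n) → (∀ {i j} → i Fin.< j → f i Fin.< f j) →
                       ∀ i → i Fin.≤ f i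
increasing⇒expansive {m = suc _} f incr =
  <-weakInduction (λ i → i Fin.≤ f i) z≤n step
  where
  step : ∀ i → inject₁ i Fin.≤ f (inject₁ i) → suc i Fin.≤ f (suc i)
  step i i≤fi = ≤-<-trans (subst (_≤ toℕ (f (inject₁ i))) (Fin.toℕ-inject₁ i) i≤fi)
                          (incr (s≤s (≤-reflexive (Fin.toℕ-inject₁ i))))

transitive-adjacent⇒< : {R : Rel (Fin n) ℓ} → Transitive R →
                        (∀ i → R (lower i) (upper i)) → ∀ {i j} → i Fin.< j → R i j
transitive-adjacent⇒< {n = suc _} {R = R} R-trans adj {i} {j} i<j
  -- The induction starts at `i` itself, where `R i i` may fail; hence the alternative `i ≡ j`.
  with <-weakInduction-startingFrom (λ j → i ≡ j ⊎ R i j) (inj₁ refl) step (<⇒≤ i<j)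
  where
  step : ∀ j → i ≡ inject₁ j ⊎ R i (inject₁ j) → i ≡ suc j ⊎ R i (suc j)
  step j (inj₁ refl) = inj₂ (adj j)
  step j (inj₂ Rij)  = inj₂ (R-trans Rij (adj j))
... | inj₁ refl = contradiction i<j (<-irrefl refl)
... | inj₂ Rij  = Rij

lower<upper : (i : Fin (pred n)) → lower {n} i Fin.< upper {n} i
lower<upper {n = suc _} i = s≤s (≤-reflexive (Fin.toℕ-inject₁ i))

module _ {V : Set a} {_≺_ : Rel V ℓ} (isSTO : IsStrictTotalOrder _≡_ _≺_) (θ : V ↔ Fin n) where
  open IsStrictTotalOrder isSTO
    using (compare; _<?_) renaming (trans to ≺-trans; irrefl to ≺-irrefl)

  private
    -- Predecessors are transported along `θ` to a `Subset n`, so that they can be counted; their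
    -- number is the rank.
    below : V → Subset n
    below v = tabulate (λ i → does (from θ i <? v))

    ∈-below⁺ : ∀ {v w} → v ≺ w → to θ v Subset.∈ below w
    ∈-below⁺ {v} {w} v≺w = lookup⇒[]= (to θ v) _
      (trans (lookup∘tabulate _ (to θ v))
             (dec-true (_ <? w) (subst (_≺ w) (sym (strictlyInverseʳ θ v)) v≺w)))

    ∈-below⁻ : ∀ {i w} → i Subset.∈ below w → from θ i ≺ w
    ∈-below⁻ {i} {w} i∈ with from θ i <? w | trans (sym (lookup∘tabulate _ i)) ([]=⇒lookup i∈)
    ... | yes p | _ = p
    ... | no _  | ()

    ∉-below : ∀ v → to θ v Subset.∉ below v
    ∉-below v = ≺-irrefl (strictlyInverseʳ θ v) ∘ ∈-below⁻

    rank< : ∀ v → ∣ below v ∣ < n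
    rank< v = subst (∣ below v ∣ <_) (∣⊤∣≡n n)
      (p⊂q⇒∣p∣<∣q∣ ((λ _ → ∈⊤) , to θ v , ∈⊤ , ∉-below v))

    rank : V → Fin n
    rank v = fromℕ< (rank< v)

    rank-mono : ∀ {v w} → v ≺ w → rank v Fin.< rank w
    rank-mono {v} {w} v≺w =
      subst₂ _<_ (sym (Fin.toℕ-fromℕ< (rank< v))) (sym (Fin.toℕ-fromℕ< (rank< w)))
        (p⊂q⇒∣p∣<∣q∣ (below-mono , to θ v , ∈-below⁺ v≺w , ∉-below v))
      where
      below-mono : below v Subset.⊆ below w
      below-mono {i} i∈ = subst (Subset._∈ below w) (strictlyInverseˡ θ i)
        (∈-below⁺ (≺-trans (∈-below⁻ i∈) v≺w))

    rank-injective : Injective _≡_ _≡_ rank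
    rank-injective {v} {w} eq with compare v w
    ... | tri< v≺w _ _ = contradiction (rank-mono v≺w) (<-irrefl (cong toℕ eq))
    ... | tri≈ _ v≡w _ = v≡w
    ... | tri> _ _ w≺v = contradiction (rank-mono w≺v) (<-irrefl (cong toℕ (sym eq)))

    rank-surjective : StrictlySurjective _≡_ rank
    rank-surjective y
      with i , eq ← injective⇒surjective (↔-injective (↔-sym θ) ∘ rank-injective) y =
      from θ i , eq

  -- Trichotomy turns strict monotonicity of `rank` into injectivity and order reflection;
  -- surjectivity is the pigeonhole principle for `rank ∘ from θ`.
  orderIsomorphism : Σ[ π ∈ V ↔ Fin n ] (∀ {v w} → to π v Fin.< to π w → v ≺ w)
  orderIsomorphism =
    ⤖⇒↔ (mk⤖ (rank-injective , strictlySurjective⇒surjective rank-surjective)) , reflects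
    where
    reflects : ∀ {v w} → rank v Fin.< rank w → v ≺ w
    reflects {v} {w} r< with compare v w
    ... | tri< v≺w _ _  = v≺w
    ... | tri≈ _ refl _ = contradiction r< (<-irrefl refl)
    ... | tri> _ _ w≺v  = contradiction (rank-mono w≺v) (<-asym r<)

-- Periodic sequences

module _ {B : Set a} (h : ℕ → B) where

  period-* : ∀ {p} → (∀ k → h (k + p) ≡ h k) → ∀ q k → h (k + q * p) ≡ h k
  period-* _  zero    k = cong h (+-identityʳ k)
  period-* {p} per (suc q) k =
    trans (cong h (sym (+-assoc k p (q * p)))) (trans (period-* per q (k + p)) (per k))

  -- Bézout in subtraction-free form, `1 + y * q ≡ x * p` or its mirror image, makes 1 a period:
  -- `y * q` steps beyond `suc k` lie `x * p` steps beyond `k`.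
  coprime-periods⇒constant : ∀ {p q} → Coprime p q →
    (∀ k → h (k + p) ≡ h k) → (∀ k → h (k + q) ≡ h k) → ∀ k → h k ≡ h 0
  coprime-periods⇒constant {p} {q} cop per-p per-q = go
    where
    shift : ∀ {p q} x y → 1 + y * q ≡ x * p →
      (∀ k → h (k + p) ≡ h k) → (∀ k → h (k + q) ≡ h k) → ∀ k → h (suc k) ≡ h k
    shift {p} {q} x y eq per-p per-q k = begin
      h (suc k)           ≡⟨ period-* per-q y (suc k) ⟨
      h (suc k + y * q)   ≡⟨ cong h (+-suc k (y * q)) ⟨
      h (k + (1 + y * q)) ≡⟨ cong (λ z → h (k + z)) eq ⟩
      h (k + x * p)       ≡⟨ period-* per-p x k ⟩
      h k                 ∎
      where open ≡-Reasoning

    step : ∀ k → h (suc k) ≡ h k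
    step with coprime-Bézout cop
    ... | Bézout.+- x y eq = shift x y eq per-p per-q
    ... | Bézout.-+ x y eq = shift y x eq per-q per-p

    go : ∀ k → h k ≡ h 0
    go zero    = refl
    go (suc k) = trans (step k) (go k)

-- The orbit of a cyclic permutation

suc-% : ∀ m n .{{_ : NonZero n}} → suc (m % n) % n ≡ suc m % n
suc-% m n = begin
  (1 + m % n) % n           ≡⟨ %-distribˡ-+ 1 (m % n) n ⟩
  (1 % n + m % n % n) % n   ≡⟨ cong (λ z → (1 % n + z) % n) (m%n%n≡m%n m n) ⟩
  (1 % n + m % n) % n       ≡⟨ %-distribˡ-+ 1 m n ⟨
  suc m % n                 ∎
  where open ≡-Reasoning

toℕ-mod : ∀ m n .{{_ : NonZero n}} → toℕ (m mod n) ≡ m % n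
toℕ-mod m n = Fin.toℕ-fromℕ< (m%n<n m n)

mod-cong : ∀ k l n .{{_ : NonZero n}} → k % n ≡ l % n → k mod n ≡ l mod n
mod-cong k l n eq = Fin.toℕ-injective (trans (toℕ-mod k n) (trans eq (sym (toℕ-mod l n))))

next-mod : ∀ k → next (k mod suc m) ≡ suc k mod suc m
next-mod {m} k = mod-cong (suc (toℕ (k mod suc m))) (suc k) (suc m)
  (trans (cong (λ z → suc z % suc m) (toℕ-mod k (suc m))) (suc-% k (suc m)))

-- Indexing the cycle by ℕ rather than `Fin n` lets shifts be plain additions, with reduction mod
-- `n` confined to `orbit-period`.
record CyclicOrbit {V : Set a} (n : ℕ) (c : V → V) (o : V) : Set a where
  orbit : ℕ → V
  orbit = fold o c

  field
    orbit-period     : ∀ k → orbit (k + n) ≡ orbit k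
    orbit-surjective : ∀ v → ∃[ k ] k < n × orbit k ≡ v

  orbit-connected : ∀ v w → ∃[ i ] ∃[ d ] orbit i ≡ v × orbit (d + i) ≡ w
  orbit-connected v w
    with i , i<n , eqᵢ ← orbit-surjective v | j , _ , eqⱼ ← orbit-surjective w =
    -- To avoid a negative `j - i`, the path runs forward from `i` to `n` and then `j` steps
    -- further.
    i , j + (n ∸ i) , eqᵢ , (begin
      orbit (j + (n ∸ i) + i)   ≡⟨ cong orbit (+-assoc j (n ∸ i) i) ⟩
      orbit (j + (n ∸ i + i))   ≡⟨ cong (λ z → orbit (j + z)) (m∸n+n≡m (<⇒≤ i<n)) ⟩
      orbit (j + n)             ≡⟨ orbit-period j ⟩
      orbit j                   ≡⟨ eqⱼ ⟩
      w                         ∎)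
    where open ≡-Reasoning

isCycle⇒cyclicOrbit : {V : Set a} (c : V ↔ V) ((v , _) : IsCycle (suc m) c) →
                      CyclicOrbit (suc m) (to c) (to v zero)
isCycle⇒cyclicOrbit {m = m} c (v , c-next) = record
  { orbit-period     = λ k → trans (orbit≡ (k + suc m))
      (trans (cong (to v) (mod-cong (k + suc m) k (suc m) ([m+n]%n≡m%n k (suc m)))) (sym (orbit≡ k)))
  ; orbit-surjective = λ w → toℕ (from v w) , Fin.toℕ<n (from v w) ,
      trans (orbit≡ (toℕ (from v w))) (trans (cong (to v) (toℕ-mod-n (from v w))) (strictlyInverseˡ v w))
  }
  where
  orbit≡ : ∀ k → fold (to v zero) (to c) k ≡ to v (k mod suc m)
  orbit≡ zero    = refl
  orbit≡ (suc k) = trans (cong (to c) (orbit≡ k))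
                         (trans (c-next (k mod suc m)) (cong (to v) (next-mod k)))

  toℕ-mod-n : ∀ i → toℕ i mod suc m ≡ i
  toℕ-mod-n i = Fin.toℕ-injective (trans (toℕ-mod (toℕ i) (suc m)) (m<n⇒m%n≡m (Fin.toℕ<n i)))

-- Lexicographic comparison of colour words

module Lexicographic {V : Set a} (c : V → V) (f : V → ℕ) where

  -- Strict lexicographic order on the first `k` letters of the colour words; words agreeing that
  -- far are incomparable, so `Lex zero` is empty.
  Lex : ℕ → V → V → Set
  Lex zero    v w = ⊥
  Lex (suc k) v w = f v < f w ⊎ (f v ≡ f w × Lex k (c v) (c w))

  lex-irrefl : ∀ k {v} → ¬ Lex k v v
  lex-irrefl (suc k) (inj₁ v<v)       = <-irrefl refl v<v
  lex-irrefl (suc k) (inj₂ (_ , lex)) = lex-irrefl k lex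

  lex-trans : ∀ k → Transitive (Lex k)
  lex-trans (suc k) (inj₁ p)        (inj₁ q)        = inj₁ (<-trans p q)
  lex-trans (suc k) (inj₁ p)        (inj₂ (q , _))  = inj₁ (<-≤-trans p (≤-reflexive q))
  lex-trans (suc k) (inj₂ (p , _))  (inj₁ q)        = inj₁ (≤-<-trans (≤-reflexive p) q)
  lex-trans (suc k) (inj₂ (p , p′)) (inj₂ (q , q′)) = inj₂ (trans p q , lex-trans k p′ q′)

  lex-asym : ∀ k {v w} → Lex k v w → ¬ Lex k w v
  lex-asym k p q = lex-irrefl k (lex-trans k p q)

  lex-suc : ∀ k {v w} → Lex k v w → Lex (suc k) v w
  lex-suc (suc k) (inj₁ p)        = inj₁ p
  lex-suc (suc k) (inj₂ (p , p′)) = inj₂ (p , lex-suc k p′)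

  lex⇒≤ : ∀ k {v w} → Lex k v w → f v ≤ f w
  lex⇒≤ (suc k) (inj₁ p)       = <⇒≤ p
  lex⇒≤ (suc k) (inj₂ (p , _)) = ≤-reflexive p

  lex-tail : ∀ k {v w} → Lex k v w → f v ≡ f w → Lex k (c v) (c w)
  lex-tail (suc k) (inj₁ p)        eq = contradiction p (<-irrefl eq)
  -- Dropping a letter shortens the comparison by one; `lex-suc` restores the length, so the same
  -- relation holds at the images under `c`.
  lex-tail (suc k) (inj₂ (_ , p′)) _  = lex-suc k p′

  module _ (o : V) where
    private
      u : ℕ → V
      u = fold o c

    lex-compare : ∀ k i j → Lex k (u i) (u j) ⊎ Lex k (u j) (u i) ⊎
                            (∀ {t} → t < k → f (u (t + i)) ≡ f (u (t + j)))
    lex-compare zero    i j = inj₂ (inj₂ λ ())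
    lex-compare (suc k) i j with <-cmp (f (u i)) (f (u j)) | lex-compare k (suc i) (suc j)
    ... | tri< p _ _ | _             = inj₁ (inj₁ p)
    ... | tri> _ _ p | _             = inj₂ (inj₁ (inj₁ p))
    ... | tri≈ _ p _ | inj₁ l        = inj₁ (inj₂ (p , l))
    ... | tri≈ _ p _ | inj₂ (inj₁ l) = inj₂ (inj₁ (inj₂ (sym p , l)))
    ... | tri≈ _ p _ | inj₂ (inj₂ e) = inj₂ (inj₂ λ
      { {zero}  _   → p
      ; {suc t} t<k → subst₂ (λ x y → f (u x) ≡ f (u y)) (+-suc t i) (+-suc t j) (e (s<s⁻¹ t<k)) })

-- Totality of the lexicographic order for prime `n`

module _ {V : Set a} {c : V → V} {o : V} (prime-n : Prime n) (cyc : CyclicOrbit n c o) (f : V → ℕ) where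
  open CyclicOrbit cyc
  open Lexicographic c f

  private
    h : ℕ → ℕ
    h = f ∘ orbit

    h-period : ∀ k → h (k + n) ≡ h k
    h-period k = cong f (orbit-period k)

  -- The difference `d` of the indices is a second period of `h`, and `0 < d < n` makes it coprime
  -- to the prime `n`.
  equal-words⇒constant : ∀ {i j} → i < j → j < n →
    (∀ {t} → t < n → h (t + i) ≡ h (t + j)) → ∀ k → h k ≡ h 0
  equal-words⇒constant {i} {j} i<j j<n agree =
    coprime-periods⇒constant h
      (prime⇒coprime prime-n {{>-nonZero (m<n⇒0<n∸m i<j)}} (≤-<-trans (m∸n≤m j i) j<n))
      h-period d-period
    where
    open ≡-Reasoning
    d = j ∸ i
    instance
      n≢0 : NonZero n
      n≢0 = >-nonZero (≤-<-trans z≤n j<n)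

    -- Agreement is given for `t < n` only; the period `n` extends it to all `t`.
    reduce : ∀ t l → h (t % n + l) ≡ h (t + l)
    reduce t l = begin
      h (t % n + l)               ≡⟨ period-* h h-period (t / n) (t % n + l) ⟨
      h (t % n + l + t / n * n)   ≡⟨ cong h (+-assoc (t % n) l (t / n * n)) ⟩
      h (t % n + (l + t / n * n)) ≡⟨ cong (λ z → h (t % n + z)) (+-comm l (t / n * n)) ⟩
      h (t % n + (t / n * n + l)) ≡⟨ cong h (+-assoc (t % n) (t / n * n) l) ⟨
      h (t % n + t / n * n + l)   ≡⟨ cong (λ z → h (z + l)) (m≡m%n+[m/n]*n t n) ⟨
      h (t + l)                   ∎

    agree-∀ : ∀ t → h (t + i) ≡ h (t + j)
    agree-∀ t = trans (sym (reduce t i)) (trans (agree (m%n<n t n)) (reduce t j))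

    cancel : ∀ k → k + (n ∸ i) + i ≡ k + n
    cancel k = trans (+-assoc k (n ∸ i) i) (cong (k +_) (m∸n+n≡m (<⇒≤ (<-trans i<j j<n))))

    swap : ∀ x y z → x + y + z ≡ x + z + y
    swap x y z = trans (+-assoc x y z) (trans (cong (x +_) (+-comm y z)) (sym (+-assoc x z y)))

    -- Adding `n`, split as `(n ∸ i) + i`, brings both sides to the form `t + j` and `t + i` with
    -- `t = k + (n ∸ i)`.
    d-period : ∀ k → h (k + d) ≡ h k
    d-period k = begin
      h (k + d)               ≡⟨ h-period (k + d) ⟨
      h (k + d + n)           ≡⟨ cong h (cancel (k + d)) ⟨
      h (k + d + (n ∸ i) + i) ≡⟨ cong (λ z → h (z + i)) (swap k d (n ∸ i)) ⟩
      h (k + (n ∸ i) + d + i) ≡⟨ cong h (+-assoc (k + (n ∸ i)) d i) ⟩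
      h (k + (n ∸ i) + (d + i)) ≡⟨ cong (λ z → h (k + (n ∸ i) + z)) (m∸n+n≡m (<⇒≤ i<j)) ⟩
      h (k + (n ∸ i) + j)     ≡⟨ agree-∀ (k + (n ∸ i)) ⟨
      h (k + (n ∸ i) + i)     ≡⟨ cong h (cancel k) ⟩
      h (k + n)               ≡⟨ h-period k ⟩
      h k                     ∎

  -- For trichotomy, both vertices are written as orbit points with indices below `n`; if `n`
  -- letters agree, distinct indices would force a constant colouring.
  lex-isStrictTotalOrder : ¬ (∀ v → f v ≡ f o) → IsStrictTotalOrder _≡_ (Lex n)
  lex-isStrictTotalOrder nonconst = record
    { isStrictPartialOrder = record
      { isEquivalence = isEquivalence
      ; irrefl        = λ { refl → lex-irrefl n }
      ; trans         = lex-trans n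
      ; <-resp-≈      = (λ { refl p → p }) , (λ { refl p → p })
      }
    ; compare = compare
    }
    where
    tri<′ : ∀ {v w} → Lex n v w → Tri (Lex n v w) (v ≡ w) (Lex n w v)
    tri<′ p = tri< p (λ { refl → lex-irrefl n p }) (lex-asym n p)

    tri>′ : ∀ {v w} → Lex n w v → Tri (Lex n v w) (v ≡ w) (Lex n w v)
    tri>′ p = tri> (lex-asym n p) (λ { refl → lex-irrefl n p }) p

    ¬constant : ¬ (∀ k → h k ≡ h 0)
    ¬constant const = nonconst λ v →
      let k , _ , eq = orbit-surjective v in trans (cong f (sym eq)) (const k)

    compare : ∀ v w → Tri (Lex n v w) (v ≡ w) (Lex n w v)
    compare v w with orbit-surjective v | orbit-surjective w
    ... | i , i<n , refl | j , j<n , refl with lex-compare o n i j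
    ...   | inj₁ p            = tri<′ p
    ...   | inj₂ (inj₁ p)     = tri>′ p
    ...   | inj₂ (inj₂ agree) with <-cmp i j
    ...     | tri< i<j _ _  = contradiction (equal-words⇒constant i<j j<n agree) ¬constant
    ...     | tri≈ _ refl _ = tri≈ (lex-irrefl n) refl (lex-irrefl n)
    ...     | tri> _ _ j<i  = contradiction (equal-words⇒constant j<i i<n (λ t<n → sym (agree t<n))) ¬constant

-- Colorings and the sets A(π, Des(π c π⁻¹))

-- Positivity proofs of a successor are equal by eta.
ℙ-≡ : ∀ {p q : ℙ} → proj₁ p ≡ proj₁ q → p ≡ q
ℙ-≡ {zero  , ()}
ℙ-≡ {suc _ , _} {suc _ , _} refl = refl

module _ {V : Set a} where

  color : Coloring V → V → ℕ
  color χ = proj₁ ∘ χ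

  module _ (c : V ↔ V) (π : 𝔖 V n) (χ : Coloring V) where

    -- The descent condition on neighbours propagates along runs of equal colours.
    A⇒step : A π (Des (conjugate π c)) χ → ∀ {v w} → to π v Fin.< to π w →
      color χ v ≤ color χ w × (color χ v ≡ color χ w → to π (to c v) Fin.< to π (to c w))
    A⇒step (weak , strict) {v} {w} v<w =
      subst₂ (λ v w → color χ v ≤ color χ w × (color χ v ≡ color χ w → to π (to c v) Fin.< to π (to c w)))
        (strictlyInverseʳ π v) (strictlyInverseʳ π w)
        (transitive-adjacent⇒< (λ {i} {j} {k} → R-trans {i} {j} {k}) adjacent v<w)
      where
      χ′ : Fin n → ℕ
      χ′ = color χ ∘ from π

      σ : Fin n → Fin n
      σ = to (conjugate π c)

      R : Rel (Fin n) _
      R i j = χ′ i ≤ χ′ j × (χ′ i ≡ χ′ j → σ i Fin.< σ j)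

      R-trans : Transitive R
      R-trans {i} {j} {k} (i≤j , f) (j≤k , g) = ≤-trans i≤j j≤k , λ i≡k →
        -- Equal colours at the ends squeeze the middle colour to the same value, so both
        -- implications fire.
        <-trans (f (≤-antisym i≤j (≤-trans j≤k (≤-reflexive (sym i≡k)))))
                (g (≤-antisym j≤k (≤-trans (≤-reflexive (sym i≡k)) i≤j)))

      adjacent : ∀ i → R (lower i) (upper i)
      -- With equal colours `i` cannot be a descent, by `strict`, and injectivity of `σ` excludes a
      -- tie.
      adjacent i = weak i , λ eq → ascent eq (<-cmp (toℕ (σ (lower i))) (toℕ (σ (upper i))))
        where
        ascent : χ′ (lower i) ≡ χ′ (upper i) → Tri _ _ _ → σ (lower i) Fin.< σ (upper i)
        ascent _  (tri< p _ _) = p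
        ascent _  (tri≈ _ p _) = contradiction
          (cong toℕ (↔-injective (conjugate π c) {lower i} {upper i} (Fin.toℕ-injective p)))
          (<⇒≢ (lower<upper i))
        ascent eq (tri> _ _ p) = contradiction (strict i p) (<-irrefl eq)

    -- If neighbours at a descent had equal colours, their tails would compare in the original
    -- direction, while the descent itself, through `reflects`, compares them in the opposite one.
    lex-reflecting⇒A : ∀ k → (∀ {v w} → to π v Fin.< to π w → Lexicographic.Lex (to c) (color χ) k v w) →
      A π (Des (conjugate π c)) χ
    lex-reflecting⇒A k reflects =
      (λ i → lex⇒≤ k (adjacent i)) ,
      (λ i i∈Des → ≤∧≢⇒< (lex⇒≤ k (adjacent i))
        λ eq → lex-asym k (lex-tail k (adjacent i) eq) (reflects i∈Des))
      where
      open Lexicographic (to c) (color χ)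

      adjacent : ∀ i → Lex k (from π (lower i)) (from π (upper i))
      adjacent i = reflects (subst₂ Fin._<_ (sym (strictlyInverseˡ π (lower i)))
        (sym (strictlyInverseˡ π (upper i))) (lower<upper i))

-- Uniqueness and existence of the bijection

module _ {V : Set a} {c : V → V} {o : V} (cyc : CyclicOrbit n c o) where
  open CyclicOrbit cyc

  -- With `w` lying `d` steps after `v`, each further `d` steps raise `r` by at least 1, so after
  -- `m` rounds it would leave `Fin m`. `R` is kept separate from the order given by `r` so that it
  -- can also record a second order.
  no-invariant-pair : (r : V → Fin m) (R : Rel V ℓ) → (∀ {v w} → R v w → r v Fin.< r w) →
    (∀ {v w} → R v w → R (c v) (c w)) → ∀ {v w} → ¬ R v w
  no-invariant-pair {m = m} r R R⇒< R-c {v} {w} Rvw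
    with i , d , refl , refl ← orbit-connected v w =
    <-irrefl refl (<-≤-trans (Fin.toℕ<n (r (orbit (m * d + i)))) (climb m))
    where
    shift : ∀ t → R (orbit (t + i)) (orbit (t + (d + i)))
    shift zero    = Rvw
    shift (suc t) = R-c (shift t)

    climb : ∀ t → t ≤ toℕ (r (orbit (t * d + i)))
    climb zero    = z≤n
    climb (suc t) = ≤-<-trans (climb t)
      (subst (λ z → r (orbit (t * d + i)) Fin.< r (orbit z))
        (trans (sym (+-assoc (t * d) d i)) (cong (_+ i) (+-comm (t * d) d)))
        (R⇒< (shift (t * d))))

module _ {V : Set a} (c : V ↔ V) {o : V} (cyc : CyclicOrbit n (to c) o) (χ : Coloring V) where

  -- Under a constant colouring every pair has equal colours, so the order given by `π` is preserved
  -- by `c`; positions 0 and 1 supply the forbidden pair.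
  A⇒nonconstant : 1 < n → (π : 𝔖 V n) → A π (Des (conjugate π c)) χ → Nonconstant χ
  A⇒nonconstant (s≤s (s≤s _)) π χ∈A (p , χ≡p) =
    no-invariant-pair cyc (to π) (λ v w → to π v Fin.< to π w) (λ v<w → v<w)
      (λ {v} {w} v<w → proj₂ (A⇒step c π χ χ∈A v<w) (cong proj₁ (trans (χ≡p v) (sym (χ≡p w)))))
      {from π zero} {from π (suc zero)}
      (subst₂ Fin._<_ (sym (strictlyInverseˡ π zero)) (sym (strictlyInverseˡ π (suc zero))) (s≤s z≤n))

  -- A pair ordered oppositely by `π` and `ρ` has colours weakly ordered both ways, hence equal, so
  -- the disagreement passes to its image under `c`.
  A-same-order : (π ρ : 𝔖 V n) → A π (Des (conjugate π c)) χ → A ρ (Des (conjugate ρ c)) χ →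
    ∀ {v w} → to π v Fin.< to π w → to ρ v Fin.< to ρ w
  A-same-order π ρ χ∈Aπ χ∈Aρ {v} {w} v<w with Fin.<-cmp (to ρ v) (to ρ w)
  ... | tri< p _ _  = p
  ... | tri≈ _ eq _ = contradiction (cong (toℕ ∘ to π) (↔-injective ρ eq)) (<⇒≢ v<w)
  ... | tri> _ _ w<v = contradiction (v<w , w<v)
    (no-invariant-pair cyc (to π) (λ v w → to π v Fin.< to π w × to ρ w Fin.< to ρ v) proj₁ step)
    where
    step : ∀ {v w} → to π v Fin.< to π w × to ρ w Fin.< to ρ v →
           to π (to c v) Fin.< to π (to c w) × to ρ (to c w) Fin.< to ρ (to c v)
    step (p , q) with v≤w , f ← A⇒step c π χ χ∈Aπ p | w≤v , g ← A⇒step c ρ χ χ∈Aρ q =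
      f (≤-antisym v≤w w≤v) , g (≤-antisym w≤v v≤w)

  -- By the common order, `to ρ ∘ from π` is strictly increasing, hence never below the identity;
  -- exchanging `π` and `ρ` then gives equality.
  A-≤ : (π ρ : 𝔖 V n) → A π (Des (conjugate π c)) χ → A ρ (Des (conjugate ρ c)) χ →
    ∀ v → to π v Fin.≤ to ρ v
  A-≤ π ρ χ∈Aπ χ∈Aρ v = subst (λ w → to π v Fin.≤ to ρ w) (strictlyInverseʳ π v)
    (increasing⇒expansive (to ρ ∘ from π) incr (to π v))
    where
    incr : ∀ {i j} → i Fin.< j → to ρ (from π i) Fin.< to ρ (from π j)
    incr {i} {j} i<j = A-same-order π ρ χ∈Aπ χ∈Aρ
      (subst₂ Fin._<_ (sym (strictlyInverseˡ π i)) (sym (strictlyInverseˡ π j)) i<j)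

  A-unique : (π ρ : 𝔖 V n) → A π (Des (conjugate π c)) χ → A ρ (Des (conjugate ρ c)) χ → π ≈𝔖 ρ
  A-unique π ρ χ∈Aπ χ∈Aρ v =
    Fin.≤-antisym (A-≤ π ρ χ∈Aπ χ∈Aρ v) (A-≤ ρ π χ∈Aρ χ∈Aπ v)

  nonconstant⇒A : Prime n → V ↔ Fin n → Nonconstant χ → ∃[ π ] A π (Des (conjugate π c)) χ
  nonconstant⇒A prime-n θ nonconst
    with π , reflects ← orderIsomorphism
      (lex-isStrictTotalOrder prime-n cyc (color χ)
        -- A constant colouring takes everywhere its value at the base point `o`.
        (λ const → nonconst (χ o , λ v → ℙ-≡ (const v)))) θ =
    π , lex-reflecting⇒A c π χ n reflects

theorem2p1 : ∀ {a} (V : Set a) (n : ℕ) → V ↔ Fin n → Prime n →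
    (c : V ↔ V) → IsCycle n c →
    IsDisjointUnion (_≈𝔖_ {n = n} {V = V}) (Nonconstant {V = V}) (λ π → A π (Des (conjugate π c)))
-- Primality excludes 0 and 1; the remaining shape of `n` provides a base point for the orbit and
-- the bound `1 < n`.
theorem2p1 V zero          θ prime-n c cycle = contradiction prime-n ¬prime[0]
theorem2p1 V (suc zero)    θ prime-n c cycle = contradiction prime-n ¬prime[1]
theorem2p1 V n@(suc (suc _)) θ prime-n c cycle =
  ( (λ {χ} → nonconstant⇒A c cyc χ prime-n θ)
  , (λ {χ} (π , χ∈A) → A⇒nonconstant c cyc χ (s≤s (s≤s z≤n)) π χ∈A) ) ,
  (λ π ρ π≉ρ {χ} (χ∈Aπ , χ∈Aρ) → π≉ρ (A-unique c cyc χ π ρ χ∈Aπ χ∈Aρ))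
  where cyc = isCycle⇒cyclicOrbit c cycle
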